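{- Let $t$ be a positive integer and let $G$ be a finite graph. If $G$ admits a Kneser-representation $\mathcal{H}$ with $\mathrm{cd}(\mathcal{H})\ge t$, then $G$ contains $K_t$ as a minor.
   Context: A hypergraph $\mathcal{H}=(V,E)$ consists of a finite vertex set $V$ and a set $E$ of subsets of $V$ (hyperedges). The Kneser graph $\mathrm{KG}(\mathcal{H})$ is the graph with vertex set $E$ in which two hyperedges $e_1,e_2$ are adjacent iff $e_1\cap e_2=\emptyset$. A hypergraph $\mathcal{H}$ is a Kneser-representation of a graph $G$ if $\mathrm{KG}(\mathcal{H})$ is isomorphic to $G$. A hypergraph is $2$-colorable if its vertices can be assigned one of two colors so that no hyperedge is entirely contained in one color class. The $2$-colorability defect of $\mathcal{H}=(V,E)$ is $\mathrm{cd}(\mathcal{H}):=\min\{|U| : U\subseteq V \text{ such that } (V\setminus U,\{e\in E: e\cap U=\emptyset\}) \text{ is 2-colorable}\}$. A graph $G$ contains $H$ as a minor if a graph isomorphic to $H$ can be obtained from $G$ by a sequence of vertex deletions, edge deletions and edge contractions. -}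

module Defs where

open import Level using (0ℓ)
open import Data.Nat using (ℕ; zero; suc; _≤_)
open import Data.Bool using (Bool; true; false)
open import Data.Fin using (Fin; punchIn)
open import Data.Fin.Subset using (Subset; _∈_; _∩_; Empty; ∣_∣)
open import Data.Product using (Σ; ∃; _×_; _,_)
open import Data.Sum using (_⊎_)
open import Relation.Nullary using (¬_)
open import Relation.Binary.PropositionalEquality using (_≡_; _≢_)
open import Function.Bundles using (_↔_; Inverse; _⇔_)
open import Function.Definitions using (Injective)

-- Finite graphs: vertex set Fin n, adjacency relation.
-- (Simplicity is not imposed as a field; all graphs below that matter
--  -- Kneser graphs, complete graphs, and their isomorphic copies -- are
--  simple, and the minor operations preserve simplicity.)

record Graph : Set₁ where
  field
    n   : ℕ
    Adj : Fin n → Fin n → Set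
open Graph public

record _≅_ (G H : Graph) : Set where
  field
    bij      : Fin (n G) ↔ Fin (n H)
    preserve : ∀ x y → Adj G x y ⇔ Adj H (Inverse.to bij x) (Inverse.to bij y)

K : ℕ → Graph
K t = record { n = t ; Adj = λ i j → i ≢ j }

deleteVertex : (G : Graph) {m : ℕ} → n G ≡ suc m → Fin (suc m) → Graph
deleteVertex G {m} Relation.Binary.PropositionalEquality.refl v =
  record { n = m ; Adj = λ i j → Adj G (punchIn v i) (punchIn v j) }

deleteEdge : (G : Graph) → Fin (n G) → Fin (n G) → Graph
deleteEdge G u v = record
  { n = n G
  ; Adj = λ x y → Adj G x y × ¬ ((x ≡ u × y ≡ v) ⊎ (x ≡ v × y ≡ u)) }

contract : (G : Graph) {m : ℕ} → n G ≡ suc m → Fin (suc m) → Fin (suc m) → Graph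
contract G {m} Relation.Binary.PropositionalEquality.refl u v = record
  { n = m
  ; Adj = λ i j → i ≢ j ×
      ( Adj G (punchIn v i) (punchIn v j)
      ⊎ (punchIn v i ≡ u × Adj G v (punchIn v j))
      ⊎ (punchIn v j ≡ u × Adj G (punchIn v i) v)) }

data _⟶*_ : Graph → Graph → Set₁ where
  done    : ∀ {G} → G ⟶* G
  delV    : ∀ {G G'} {m} (e : n G ≡ suc m) (v : Fin (suc m)) →
            deleteVertex G e v ⟶* G' → G ⟶* G'
  delE    : ∀ {G G'} (u v : Fin (n G)) → Adj G u v →
            deleteEdge G u v ⟶* G' → G ⟶* G'
  contr   : ∀ {G G'} {m} (e : n G ≡ suc m) (u v : Fin (suc m)) →
            u ≢ v → Adj G (Data.Fin.cast (Relation.Binary.PropositionalEquality.sym e) u)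
                          (Data.Fin.cast (Relation.Binary.PropositionalEquality.sym e) v) →
            contract G e u v ⟶* G' → G ⟶* G'

HasMinor : Graph → Graph → Set₁
HasMinor G H = Σ Graph λ G' → (G ⟶* G') × (G' ≅ H)

-- Hypergraphs: vertex set Fin m, hyperedges indexed injectively by Fin k
-- (injectivity: E is a *set* of subsets).

record Hypergraph : Set where
  field
    m    : ℕ
    k    : ℕ
    edge : Fin k → Subset m
    inj  : Injective _≡_ _≡_ edge
open Hypergraph public

KG : Hypergraph → Graph
KG H = record
  { n = k H
  ; Adj = λ i j → i ≢ j × Empty (edge H i ∩ edge H j) }

-- Is the sub-hypergraph (V ∖ U, {e ∈ E : e ∩ U = ∅}) 2-colorable?
-- A colouring is c : Fin m → Bool; only its values on V ∖ U matter, since every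
-- remaining hyperedge lies inside V ∖ U.
TwoColorableAfterRemoving : (H : Hypergraph) → Subset (m H) → Set
TwoColorableAfterRemoving H U =
  Σ (Fin (m H) → Bool) λ c →
    ∀ (i : Fin (k H)) → Empty (edge H i ∩ U) →
      ¬ (∀ x → x ∈ edge H i → c x ≡ true) × ¬ (∀ x → x ∈ edge H i → c x ≡ false)

IsColorabilityDefect : Hypergraph → ℕ → Set
IsColorabilityDefect H d =
  (Σ (Subset (m H)) λ U → ∣ U ∣ ≡ d × TwoColorableAfterRemoving H U)
  × (∀ U → TwoColorableAfterRemoving H U → d ≤ ∣ U ∣)

{-# OPTIONS --safe #-}

-- Let U be a set of d vertices whose removal leaves a 2-colourable hypergraph.
-- By minimality, recolouring u ∈ U with either colour and putting it back fails, so
-- there are hyperedges e u and f u which contain u, no other vertex of U, and apart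
-- from u only vertices of the first, respectively second, colour.  Then
-- e u ∩ f v = ∅ exactly when u ≢ v: the Kneser graph contains a crown, i.e. K_{d,d}
-- minus a perfect matching.  For d ≥ 3, contracting the edges e u — f (next u) for
-- a cyclic successor function next yields K_d.  The only degeneracy is e u ≡ f u;
-- such a vertex is adjacent to all the others and is a branch set by itself.
module Submission where

open import Defs
open import Data.Bool using (Bool; true; false)
import Data.Bool.Properties as Bool
open import Data.Fin using (Fin; zero; suc; _≟_; punchIn; punchOut; inject≤; cast)
open import Data.Fin.Properties
  using (any?; all?; cast-is-id; inject≤-injective; suc-injective;
         punchIn-punchOut; punchOut-injective)
open import Data.Fin.Subset using (Subset; inside; outside; _∈_; _∉_; _∩_; _-_; Empty; ∣_∣)
open import Data.Fin.Subset.Properties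
  using (_∈?_; x∈p∩q⁺; x∈p∩q⁻; x∈p∧x≢y⇒x∈p-y; x∈p⇒∣p-x∣<∣p∣)
open import Data.List using (List; []; _∷_; _++_; map; filter; length; lookup; allFin)
open import Data.List.Membership.Propositional.Properties using (∈-lookup)
open import Data.List.Properties using (length-++; length-map; length-tabulate)
open import Data.List.Relation.Unary.All as All using (All; []; _∷_)
import Data.List.Relation.Unary.All.Properties as All
open import Data.List.Relation.Unary.AllPairs using (AllPairs; []; _∷_)
import Data.List.Relation.Unary.AllPairs.Properties as AllPairs
open import Data.List.Relation.Unary.Unique.Propositional using (Unique)
import Data.List.Relation.Unary.Unique.Propositional.Properties as Unique
open import Data.Nat using (ℕ; zero; suc; _+_; _≤_)
open import Data.Nat.Properties using (+-suc; ≤⇒≯)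
open import Data.Product using (Σ; ∃; _×_; _,_; proj₁; proj₂)
open import Data.Sum using (_⊎_; inj₁; inj₂; swap)
open import Data.Vec using ([]; _∷_; here; there)
open import Data.Vec.Functional using (updateAt)
open import Data.Vec.Functional.Properties using (updateAt-updates; updateAt-minimal)
open import Function using (_∘_; const; id)
open import Function.Bundles using (Inverse; Equivalence; mk↔ₛ′; mk⇔)
open import Function.Definitions using (Injective)
open import Relation.Binary using (Rel; Symmetric)
open import Relation.Binary.PropositionalEquality
  using (_≡_; _≢_; refl; sym; trans; cong; cong₂; subst; subst₂; ≢-sym)
open import Relation.Nullary using (¬_; yes; no; contradiction; ¬?)
open import Relation.Nullary.Decidable using (_×-dec_; _→-dec_; decidable-stable)
open import Relation.Unary using (Pred; Decidable)

graph : ∀ {n} → (Fin n → Fin n → Set) → Graph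
graph {n} A = record { n = n ; Adj = A }

HasMinor-prepend : ∀ {G G' H} → (∀ {G''} → G' ⟶* G'' → G ⟶* G'') →
                   HasMinor G' H → HasMinor G H
HasMinor-prepend step (G'' , steps , iso) = G'' , step steps , iso

-- Minors from branch sets of size at most two

-- Vertices outside the image of `p` are deleted one at a time, so `n` decreases. Once `p` is onto
-- it is a bijection, and `irrefl` together with `adj` makes adjacency coincide with inequality of
-- indices.
clique⇒minor : ∀ n {t} {A : Fin n → Fin n → Set} (p : Fin t → Fin n) →
               (∀ {x} → ¬ A x x) → Injective _≡_ _≡_ p →
               (∀ {i j} → i ≢ j → A (p i) (p j)) → HasMinor (graph A) (K t)
clique⇒minor n {t} {A} p irrefl inj adj with any? (λ v → ¬? (any? (λ i → v ≟ p i)))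
clique⇒minor (suc n) {t} {A} p irrefl inj adj | yes (v , v∉p) =
  HasMinor-prepend (delV refl v)
    (clique⇒minor n p' irrefl (inj ∘ punchOut-injective (v≢p _) (v≢p _))
      (λ i≢j → subst₂ A (sym (punchIn-p' _)) (sym (punchIn-p' _)) (adj i≢j)))
  where
  v≢p : ∀ i → v ≢ p i
  v≢p i eq = v∉p (i , eq)
  p' : Fin t → Fin n
  p' i = punchOut (v≢p i)
  punchIn-p' : ∀ i → punchIn v (p' i) ≡ p i
  punchIn-p' i = punchIn-punchOut (v≢p i)
clique⇒minor n {t} {A} p irrefl inj adj | no surj = _ , done , record
  { bij = mk↔ₛ′ index p (λ i → inj (sym (index-spec (p i)))) (λ v → sym (index-spec v))
  ; preserve = λ x y → mk⇔
      (λ Axy eq → irrefl (subst (A x) (sym (index-injective eq)) Axy))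
      (λ i≢j → subst₂ A (sym (index-spec x)) (sym (index-spec y)) (adj i≢j))
  }
  where
  preimage : ∀ v → ∃ λ i → v ≡ p i
  preimage v = decidable-stable (any? λ i → v ≟ p i) (λ v∉p → surj (v , v∉p))
  index : Fin n → Fin t
  index v = proj₁ (preimage v)
  index-spec : ∀ v → v ≡ p (index v)
  index-spec v = proj₂ (preimage v)
  index-injective : ∀ {x y} → index x ≡ index y → x ≡ y
  index-injective {x} {y} eq = trans (index-spec x) (trans (cong p eq) (sym (index-spec y)))

-- Contracting an edge

module _ {n} {u v : Fin (suc n)} (v≢u : v ≢ u) where

  -- The quotient map of `contract`: surviving vertices are labelled through `punchIn v`, so `v`
  -- goes to the label of `u`.
  merge : Fin (suc n) → Fin n
  merge x with v ≟ x
  ... | yes _   = punchOut v≢u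
  ... | no  v≢x = punchOut v≢x

  punchIn-merge : ∀ x → (x ≡ v × punchIn v (merge x) ≡ u) ⊎ (punchIn v (merge x) ≡ x)
  punchIn-merge x with v ≟ x
  ... | yes v≡x = inj₁ (sym v≡x , punchIn-punchOut v≢u)
  ... | no  v≢x = inj₂ (punchIn-punchOut v≢x)

  -- The endpoints cannot both be `v`, since their images differ; the other three cases are the
  -- three alternatives in the adjacency of `contract`.
  merge-adjacent : ∀ (A : Fin (suc n) → Fin (suc n) → Set) {x y} → A x y →
                   merge x ≢ merge y →
                   Adj (contract (graph A) refl u v) (merge x) (merge y)
  merge-adjacent A {x} {y} Axy x≢y = x≢y , adj (punchIn-merge x) (punchIn-merge y)
    where
    adj : (x ≡ v × punchIn v (merge x) ≡ u) ⊎ (punchIn v (merge x) ≡ x) →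
          (y ≡ v × punchIn v (merge y) ≡ u) ⊎ (punchIn v (merge y) ≡ y) → _
    adj (inj₁ (refl , _)) (inj₁ (refl , _)) = contradiction refl x≢y
    adj (inj₁ (refl , p)) (inj₂ q)          = inj₂ (inj₁ (p , subst (A v) (sym q) Axy))
    adj (inj₂ p)          (inj₁ (refl , q)) =
      inj₂ (inj₂ (q , subst (λ z → A z v) (sym p) Axy))
    adj (inj₂ p)          (inj₂ q)          = inj₁ (subst₂ A (sym p) (sym q) Axy)

contract-symmetric : ∀ {n} {A : Fin (suc n) → Fin (suc n) → Set} {u v} → Symmetric A →
                     Symmetric (Adj (contract (graph A) refl u v))
contract-symmetric A-sym (i≢j , inj₁ a)              = ≢-sym i≢j , inj₁ (A-sym a)
contract-symmetric A-sym (i≢j , inj₂ (inj₁ (p , a))) =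
  ≢-sym i≢j , inj₂ (inj₂ (p , A-sym a))
contract-symmetric A-sym (i≢j , inj₂ (inj₂ (p , a))) =
  ≢-sym i≢j , inj₂ (inj₁ (p , A-sym a))

-- The i-th branch set is { branch true i , branch false i }.
record PairModel {n} (A : Fin n → Fin n → Set) (t : ℕ) : Set where
  field
    branch   : Bool → Fin t → Fin n
    disjoint : ∀ {s s' i j} → branch s i ≡ branch s' j → i ≡ j
    joined   : ∀ i → branch true i ≡ branch false i ⊎ A (branch true i) (branch false i)
    linked   : ∀ {i j} → i ≢ j →
               A (branch true i) (branch false j) ⊎ A (branch true j) (branch false i)

-- Only two vertices of the same branch set are identified, so the quotient map carries the model to
-- a model.
contractBranch : ∀ {n t} {A : Fin (suc n) → Fin (suc n) → Set} (M : PairModel A t) →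
                 let open PairModel M in
                 ∀ k → branch false k ≢ branch true k →
                 PairModel (Adj (contract (graph A) refl (branch true k) (branch false k))) t
contractBranch {n} {t} {A} M k v≢u = record
  { branch   = λ s i → γ (branch s i)
  ; disjoint = disj
  ; joined   = join
  ; linked   = λ i≢j → link i≢j (linked i≢j)
  }
  where
  open PairModel M
  γ : Fin (suc n) → Fin n
  γ = merge v≢u

  -- The removed vertex and its replacement both belong to the `k`-th branch set and to no other, so
  -- the label of an image still names a vertex of the `i`-th branch set.
  representative : ∀ s i → Σ Bool λ s' → punchIn (branch false k) (γ (branch s i)) ≡ branch s' i
  representative s i with punchIn-merge v≢u (branch s i)
  ... | inj₂ p = s , p
  ... | inj₁ (q , p) with disjoint q
  ...   | refl = true , p

  disj : ∀ {s s' i j} → γ (branch s i) ≡ γ (branch s' j) → i ≡ j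
  disj {s} {s'} {i} {j} eq = disjoint
    (trans (sym (proj₂ (representative s i)))
      (trans (cong (punchIn (branch false k)) eq) (proj₂ (representative s' j))))

  join : ∀ i → _
  join i with γ (branch true i) ≟ γ (branch false i) | joined i
  ... | yes eq | _      = inj₁ eq
  ... | no _   | inj₁ p = inj₁ (cong γ p)
  ... | no neq | inj₂ a = inj₂ (merge-adjacent v≢u A a neq)

  link : ∀ {i j} → i ≢ j → _ → _
  link i≢j (inj₁ a) = inj₁ (merge-adjacent v≢u A a (i≢j ∘ disj))
  link i≢j (inj₂ a) = inj₂ (merge-adjacent v≢u A a (≢-sym i≢j ∘ disj))

-- Contracting a branch set with two distinct ends removes a vertex, which drives the recursion.
-- When no such branch set is left, the `true` ends form a clique.
pairModel⇒minor : ∀ n {t} {A : Fin n → Fin n → Set} → (∀ {x} → ¬ A x x) → Symmetric A →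
                  PairModel A t → HasMinor (graph A) (K t)
pairModel⇒minor n {t} {A} irrefl A-sym M
  with any? (λ i → ¬? (PairModel.branch M true i ≟ PairModel.branch M false i))
pairModel⇒minor zero irrefl A-sym M | yes (k , _) with () ← PairModel.branch M true k
pairModel⇒minor (suc n) {t} {A} irrefl A-sym M | yes (k , u≢v) =
  HasMinor-prepend (contr refl (branch true k) (branch false k) u≢v uv)
    (pairModel⇒minor n {A = Adj (contract (graph A) refl (branch true k) (branch false k))}
      (λ (x≢x , _) → x≢x refl) (contract-symmetric {A = A} A-sym)
      (contractBranch M k (≢-sym u≢v)))
  where
  open PairModel M
  uv : A (cast refl (branch true k)) (cast refl (branch false k))
  uv with joined k
  ... | inj₁ u≡v = contradiction u≡v u≢v
  ... | inj₂ a   = subst₂ A (sym (cast-is-id refl _)) (sym (cast-is-id refl _)) a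
pairModel⇒minor n {t} {A} irrefl A-sym M | no ¬distinct =
  clique⇒minor n (branch true) irrefl disjoint (λ i≢j → adj (linked i≢j))
  where
  open PairModel M
  same : ∀ i → branch false i ≡ branch true i
  same i = sym (decidable-stable (branch true i ≟ branch false i) (λ ne → ¬distinct (i , ne)))
  adj : ∀ {i j} → A (branch true i) (branch false j) ⊎ A (branch true j) (branch false i) →
        A (branch true i) (branch true j)
  adj {j = j} (inj₁ a) = subst (A _) (same j) a
  adj {i}     (inj₂ a) = A-sym (subst (A _) (same i) a)

-- Crowns

AllPairs-lookup : ∀ {a ℓ} {X : Set a} {R : Rel X ℓ} → Symmetric R → ∀ {xs} →
                  AllPairs R xs → ∀ {i j} → i ≢ j → R (lookup xs i) (lookup xs j)
AllPairs-lookup R-sym (_  ∷ _)  {zero}  {zero}  i≢j = contradiction refl i≢j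
AllPairs-lookup R-sym (rs ∷ _)  {zero}  {suc j} i≢j = All.lookup rs (∈-lookup j)
AllPairs-lookup R-sym (rs ∷ _)  {suc i} {zero}  i≢j = R-sym (All.lookup rs (∈-lookup i))
AllPairs-lookup R-sym (_  ∷ ps) {suc i} {suc j} i≢j =
  AllPairs-lookup R-sym ps (i≢j ∘ cong suc)

length-filter-split : ∀ {a p} {X : Set a} {P : Pred X p} (P? : Decidable P) xs →
                      length (filter P? xs) + length (filter (¬? ∘ P?) xs) ≡ length xs
length-filter-split P? [] = refl
length-filter-split P? (x ∷ xs) with P? x
... | yes _ = cong suc (length-filter-split P? xs)
... | no  _ = trans (+-suc _ _) (cong suc (length-filter-split P? xs))

module Crown {n t} {A : Fin n → Fin n → Set} (irrefl : ∀ {x} → ¬ A x x) (A-sym : Symmetric A)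
             (e f : Fin t → Fin n) (adj : ∀ {i j} → i ≢ j → A (e i) (f j))
             (nonadj : ∀ i → ¬ A (e i) (f i)) where

  Pair : Set
  Pair = Bool → Fin n

  -- `Joined` and `Apart` are the conditions of `PairModel` on one pair and on two pairs, in a form
  -- that `All` and `AllPairs` can carry along a list.
  Joined : Pair → Set
  Joined z = z true ≡ z false ⊎ A (z true) (z false)

  Apart : Pair → Pair → Set
  Apart z w = (∀ s s' → z s ≢ w s') × (A (z true) (w false) ⊎ A (w true) (z false))

  Apart-sym : Symmetric Apart
  Apart-sym (ne , link) = (λ s s' → ≢-sym (ne s' s)) , swap link

  Degenerate : Fin t → Set
  Degenerate i = e i ≡ f i

  -- A neighbour tells them apart: `f j` is adjacent to `e i` but not to `e j`.
  e≢e : ∀ {i j} → i ≢ j → e i ≢ e j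
  e≢e {i} {j} i≢j eq = nonadj j (subst (λ x → A x (f j)) eq (adj i≢j))

  f≢f : ∀ {i j} → i ≢ j → f i ≢ f j
  f≢f {i} {j} i≢j eq = nonadj i (subst (A (e i)) (sym eq) (adj i≢j))

  e≢f′ : ∀ {i j} → i ≢ j → e i ≢ f j
  e≢f′ {i} i≢j eq = irrefl (subst (A (e i)) (sym eq) (adj i≢j))

  e≢f : ∀ {i} → ¬ Degenerate i → ∀ j → e i ≢ f j
  e≢f {i} nd j with i ≟ j
  ... | yes refl = nd
  ... | no  i≢j  = e≢f′ i≢j

  -- Pairing along a cyclic order of the indices

  pair : Fin t → Fin t → Pair
  pair i j true  = e i
  pair i j false = f j

  -- Each index is paired with its successor. The last one is paired with `z`, which `cycle` takes
  -- to be its first index.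
  chain : Fin t → List (Fin t) → Fin t → List Pair
  chain a []       z = pair a z ∷ []
  chain a (b ∷ bs) z = pair a b ∷ chain b bs z

  cycle : List (Fin t) → List Pair
  cycle []               = []
  cycle (i ∷ [])         = const (e i) ∷ []
  -- The rotation would give { e i , f j } and { e j , f i }, which need not be linked.
  cycle (i ∷ j ∷ [])     = const (e i) ∷ const (f j) ∷ []
  cycle (i ∷ j ∷ k ∷ is) = pair i j ∷ pair j k ∷ chain k is i

  -- The `true` ends run over `a ∷ bs`, the `false` ends over `bs` and `z`; hence separate
  -- predicates and index lists.
  All-chain : ∀ {P Q : Fin n → Set} {a bs z} → All (P ∘ e) (a ∷ bs) → All (Q ∘ f) bs →
              Q (f z) → All (λ w → P (w true) × Q (w false)) (chain a bs z)
  All-chain (p ∷ [])         []       q  = (p , q) ∷ []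
  All-chain {P} {Q} (p ∷ ps@(_ ∷ _)) (q ∷ qs) qz = (p , q) ∷ All-chain {P} {Q} ps qs qz

  All-cycle : ∀ {P : Fin n → Set} {is} → All (P ∘ e) is → All (P ∘ f) is →
              All (λ w → P (w true) × P (w false)) (cycle is)
  All-cycle []               []               = []
  All-cycle (p ∷ [])         (q ∷ [])         = (p , p) ∷ []
  All-cycle (p ∷ p' ∷ [])    (q ∷ q' ∷ [])    = (p , p) ∷ (q' , q') ∷ []
  All-cycle {P} (p ∷ p' ∷ p″ ∷ ps) (q ∷ q' ∷ q″ ∷ qs) =
    (p , q') ∷ (p' , q″) ∷ All-chain {P} {P} (p″ ∷ ps) qs q

  chain-joined : ∀ {a bs z} → Unique (a ∷ bs) → All (_≢ z) (a ∷ bs) → All Joined (chain a bs z)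
  chain-joined {bs = []}     _                 (a≢z ∷ _)  = inj₂ (adj a≢z) ∷ []
  chain-joined {bs = b ∷ bs} ((a≢b ∷ _) ∷ uniq) (_ ∷ ≢z) = inj₂ (adj a≢b) ∷ chain-joined uniq ≢z

  cycle-joined : ∀ {is} → Unique is → All Joined (cycle is)
  cycle-joined {[]}             _ = []
  cycle-joined {i ∷ []}         _ = inj₁ refl ∷ []
  cycle-joined {i ∷ j ∷ []}     _ = inj₁ refl ∷ inj₁ refl ∷ []
  cycle-joined {i ∷ j ∷ k ∷ is} ((i≢j ∷ i≢ks) ∷ (j≢k ∷ _) ∷ uniq) =
    inj₂ (adj i≢j) ∷ inj₂ (adj j≢k) ∷ chain-joined uniq (All.map ≢-sym i≢ks)

  -- The first pair is linked to a later pair with `false` end `f y` through `e a`, because `y` is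
  -- never `a`. Nondegeneracy separates `f b` from `e b` in the next pair.
  chain-apart : ∀ {a bs z} → All (¬_ ∘ Degenerate) (a ∷ bs) → Unique (a ∷ bs) →
                All (_≢ z) (a ∷ bs) → AllPairs Apart (chain a bs z)
  chain-apart {bs = []}     _  _ _ = [] ∷ []
  chain-apart {a} {b ∷ bs} {z} (nda ∷ nd) ((a≢b ∷ a≢bs) ∷ uniq@(b≢bs ∷ _)) (a≢z ∷ ≢z@(b≢z ∷ _)) =
    All.map apart
      (All-chain {P = λ v → e a ≢ v × f b ≢ v} {Q = λ v → f b ≢ v × A (e a) v}
        (All.zipWith (λ (a≢x , nd) → e≢e a≢x , ≢-sym (e≢f nd b)) (a≢b ∷ a≢bs , nd))
        (All.zipWith (λ (a≢y , b≢y) → f≢f b≢y , adj a≢y) (a≢bs , b≢bs))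
        (f≢f b≢z , adj a≢z))
    ∷ chain-apart nd uniq ≢z
    where
    apart : ∀ {w} → (e a ≢ w true × f b ≢ w true) × (f b ≢ w false × A (e a) (w false)) →
            Apart (pair a b) w
    apart {w} ((ea≢ , fb≢) , (fb≢' , Aea)) = ne , inj₁ Aea
      where
      ne : ∀ s s' → pair a b s ≢ w s'
      ne true  true  = ea≢
      ne true  false eq = irrefl (subst (A (e a)) (sym eq) Aea)
      ne false true  = fb≢
      ne false false = fb≢'

  -- With three or more indices, the last `false` end is `f i`, not adjacent to `e i`. The first
  -- pair is therefore linked to the pairs from `k` onwards through `f j`, and to `pair j k` through
  -- `e i` and `f k`.
  cycle-apart : ∀ {is} → All (¬_ ∘ Degenerate) is → Unique is → AllPairs Apart (cycle is)
  cycle-apart {[]}             _  _ = []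
  cycle-apart {i ∷ []}         _  _ = [] ∷ []
  cycle-apart {i ∷ j ∷ []}     _  ((i≢j ∷ _) ∷ _) =
    (((λ _ _ → e≢f′ i≢j) , inj₁ (adj i≢j)) ∷ []) ∷ [] ∷ []
  cycle-apart {i ∷ j ∷ k ∷ is} (ndi ∷ nds@(ndj ∷ ndks))
              ((i≢j ∷ i≢ks@(i≢k ∷ i≢is)) ∷ uniq@((j≢k ∷ j≢is) ∷ _)) =
    (first ∷ All.map apart
      (All-chain {P = λ v → e i ≢ v × f j ≢ v × A v (f j)} {Q = λ v → e i ≢ v × f j ≢ v}
        (All.zipWith (λ (i≢x , j≢x , nd) → e≢e i≢x , ≢-sym (e≢f nd j) , adj (≢-sym j≢x))
          (i≢ks , All.zip (j≢k ∷ j≢is , ndks)))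
        (All.zipWith (λ (i≢y , j≢y) → e≢f′ i≢y , f≢f j≢y) (i≢is , j≢is))
        (ndi , f≢f (≢-sym i≢j))))
    -- The remaining pairs are `chain j (k ∷ is) i` by definition.
    ∷ chain-apart nds uniq (All.map ≢-sym (i≢j ∷ i≢ks))
    where
    first : Apart (pair i j) (pair j k)
    first = ne , inj₁ (adj i≢k)
      where
      ne : ∀ s s' → pair i j s ≢ pair j k s'
      ne true  true  = e≢e i≢j
      ne true  false = e≢f′ i≢k
      ne false true  = ≢-sym ndj
      ne false false = f≢f j≢k
    apart : ∀ {w} → (e i ≢ w true × f j ≢ w true × A (w true) (f j)) ×
                    (e i ≢ w false × f j ≢ w false) → Apart (pair i j) w
    apart {w} ((ei≢ , fj≢ , a) , (ei≢' , fj≢')) = ne , inj₂ a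
      where
      ne : ∀ s s' → pair i j s ≢ w s'
      ne true  true  = ei≢
      ne true  false = ei≢'
      ne false true  = fj≢
      ne false false = fj≢'

  length-chain : ∀ a bs z → length (chain a bs z) ≡ suc (length bs)
  length-chain a []       z = refl
  length-chain a (b ∷ bs) z = cong suc (length-chain b bs z)

  length-cycle : ∀ is → length (cycle is) ≡ length is
  length-cycle []               = refl
  length-cycle (i ∷ [])         = refl
  length-cycle (i ∷ j ∷ [])     = refl
  length-cycle (i ∷ j ∷ k ∷ is) = cong (λ l → suc (suc l)) (length-chain k is i)

  -- The vertex plays both roles: as `f i` it is adjacent to `e j`, as `e i` to `f j`.
  degenerate-adjacent : ∀ {i j} → Degenerate i → i ≢ j → A (e i) (e j) × A (e i) (f j)
  degenerate-adjacent {i} {j} eq i≢j =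
    A-sym (subst (A (e j)) (sym eq) (adj (≢-sym i≢j))) , adj i≢j

  const-apart : ∀ {v w} → A v (w true) × A v (w false) → Apart (const v) w
  const-apart {v} {w} (a , a') = (λ _ → ne) , inj₁ a'
    where
    ne : ∀ s → v ≢ w s
    ne true  eq = irrefl (subst (A v) (sym eq) a)
    ne false eq = irrefl (subst (A v) (sym eq) a')

  singletons : List (Fin t) → List Pair
  singletons = map (λ i → const (e i))

  singletons-apart : ∀ {is} → All Degenerate is → Unique is → AllPairs Apart (singletons is)
  singletons-apart []       []            = []
  singletons-apart (d ∷ ds) (i≢is ∷ uniq) =
    All.map⁺ (All.map (λ i≢j → let a = proj₁ (degenerate-adjacent d i≢j)
                               in const-apart (a , a)) i≢is)
    ∷ singletons-apart ds uniq

  -- Assembling `t` branch sets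

  degenerate? : Decidable Degenerate
  degenerate? i = e i ≟ f i

  degenerates nondegenerates : List (Fin t)
  degenerates    = filter degenerate? (allFin t)
  nondegenerates = filter (¬? ∘ degenerate?) (allFin t)

  pairs : List Pair
  pairs = singletons degenerates ++ cycle nondegenerates

  degenerates-degenerate : All Degenerate degenerates
  degenerates-degenerate = All.all-filter degenerate? (allFin t)

  nondegenerates-nondegenerate : All (¬_ ∘ Degenerate) nondegenerates
  nondegenerates-nondegenerate = All.all-filter (¬? ∘ degenerate?) (allFin t)

  pairs-apart : AllPairs Apart pairs
  pairs-apart = AllPairs.++⁺
    (singletons-apart degenerates-degenerate
      (Unique.filter⁺ degenerate? (Unique.allFin⁺ t)))
    (cycle-apart nondegenerates-nondegenerate
      (Unique.filter⁺ (¬? ∘ degenerate?) (Unique.allFin⁺ t)))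
    (All.map⁺ (All.map apart degenerates-degenerate))
    where
    apart : ∀ {i} → Degenerate i → All (Apart (const (e i))) (cycle nondegenerates)
    apart {i} d = All.map const-apart
      (All-cycle {P = A (e i)} (All.map (proj₁ ∘ a) nondegenerates-nondegenerate)
                 (All.map (proj₂ ∘ a) nondegenerates-nondegenerate))
      where
      a : ∀ {j} → ¬ Degenerate j → A (e i) (e j) × A (e i) (f j)
      -- Exactly one of the two indices is degenerate, so they differ.
      a nd = degenerate-adjacent d (λ { refl → nd d })

  pairs-joined : All Joined pairs
  pairs-joined = All.++⁺
    (All.map⁺ (All.universal (λ _ → inj₁ refl) degenerates))
    (cycle-joined (Unique.filter⁺ (¬? ∘ degenerate?) (Unique.allFin⁺ t)))

  length-pairs : length pairs ≡ t
  length-pairs = trans (length-++ (singletons degenerates))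
    (trans (cong₂ _+_ (length-map _ degenerates) (length-cycle nondegenerates))
      (trans (length-filter-split degenerate? (allFin t)) (length-tabulate id)))

  model : PairModel A (length pairs)
  model = record
    { branch   = λ s i → lookup pairs i s
    ; disjoint = λ {s} {s'} {i} {j} eq → decidable-stable (i ≟ j) λ i≢j →
        proj₁ (AllPairs-lookup Apart-sym pairs-apart i≢j) s s' eq
    ; joined   = λ i → All.lookup pairs-joined (∈-lookup i)
    ; linked   = λ i≢j → proj₂ (AllPairs-lookup Apart-sym pairs-apart i≢j)
    }

  crown⇒minor : HasMinor (graph A) (K t)
  crown⇒minor = subst (HasMinor (graph A) ∘ K) length-pairs
    (pairModel⇒minor n irrefl A-sym model)

-- The crown of a minimum removal set

elements : ∀ {n} (p : Subset n) →
           Σ (Fin ∣ p ∣ → Fin n) λ ι → Injective _≡_ _≡_ ι × (∀ i → ι i ∈ p)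
elements [] = (λ ()) , (λ { {()} }) , λ ()
elements (outside ∷ p) with elements p
... | ι , inj , mem = suc ∘ ι , inj ∘ suc-injective , there ∘ mem
elements (inside ∷ p) with elements p
... | ι , inj , mem = ι' , inj' , mem'
  where
  ι' : Fin (suc ∣ p ∣) → Fin _
  ι' zero    = zero
  ι' (suc i) = suc (ι i)
  inj' : Injective _≡_ _≡_ ι'
  inj' {zero}  {zero}  _  = refl
  inj' {suc _} {suc _} eq = cong suc (inj (suc-injective eq))
  mem' : ∀ i → ι' i ∈ inside ∷ p
  mem' zero    = here
  mem' (suc i) = there (mem i)

module _ (H : Hypergraph) (U : Subset (m H)) (c : Fin (m H) → Bool) where

  -- Such an edge survives and becomes monochromatic when `u` is taken out of `U` and given colour
  -- `s`.
  Critical : Bool → Fin (m H) → Fin (k H) → Set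
  Critical s u i = u ∈ edge H i × (∀ x → x ∈ edge H i → x ≢ u → x ∉ U × c x ≡ s)

  critical? : ∀ s u → Decidable (Critical s u)
  critical? s u i = (u ∈? edge H i) ×-dec
    all? (λ x → (x ∈? edge H i) →-dec (¬? (x ≟ u) →-dec (¬? (x ∈? U) ×-dec (c x Bool.≟ s))))

  -- A common vertex other than `u` and `v` would have both colours. If it is `u`, the second edge
  -- meets `U` outside `v`; if it is `v`, the first meets `U` outside `u`.
  critical-disjoint : ∀ {u v i j} → u ∈ U → v ∈ U → u ≢ v →
                      Critical true u i → Critical false v j → Empty (edge H i ∩ edge H j)
  critical-disjoint {u} {v} {i} {j} u∈U v∈U u≢v (_ , ci) (_ , cj) (x , x∈)
    with x∈p∩q⁻ (edge H i) (edge H j) x∈ | x ≟ u | x ≟ v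
  ... | _         | yes refl | yes refl = u≢v refl
  ... | _ , x∈j   | yes refl | no x≢v   = proj₁ (cj x x∈j x≢v) u∈U
  ... | x∈i , _   | no x≢u   | yes refl = proj₁ (ci x x∈i x≢u) v∈U
  ... | x∈i , x∈j | no x≢u   | no x≢v
    with () ← trans (sym (proj₂ (ci x x∈i x≢u))) (proj₂ (cj x x∈j x≢v))

  -- Otherwise `U - u`, with `u` recoloured `s`, would be a smaller removal set. Decidability of
  -- `Critical` turns this contradiction into a witness.
  critical-exists : (∀ i → Empty (edge H i ∩ U) → ∀ s → ¬ (∀ x → x ∈ edge H i → c x ≡ s)) →
                    (∀ U' → TwoColorableAfterRemoving H U' → ∣ U ∣ ≤ ∣ U' ∣) →
                    ∀ s {u} → u ∈ U → ∃ (Critical s u)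
  critical-exists proper minimal s {u} u∈U =
    decidable-stable (any? (critical? s u)) λ none →
      ≤⇒≯ (minimal (U - u) (c' , λ i disj → proper' none i disj true , proper' none i disj false))
          (x∈p⇒∣p-x∣<∣p∣ u∈U)
    where
    c' : Fin (m H) → Bool
    c' = updateAt c u (const s)

    c≡c' : ∀ {x} → x ≢ u → c x ≡ c' x
    c≡c' x≢u = sym (updateAt-minimal _ u c x≢u)

    proper' : ¬ ∃ (Critical s u) → ∀ i → Empty (edge H i ∩ (U - u)) →
              ∀ s' → ¬ (∀ x → x ∈ edge H i → c' x ≡ s')
    proper' none i disj s' mono with u ∈? edge H i
    -- The single colour of the edge is that of `u`, namely `s`, so the edge would be critical.
    ... | yes u∈i = none (i , u∈i , λ x x∈i x≢u →
            (λ x∈U → disj (x , x∈p∩q⁺ (x∈i , x∈p∧x≢y⇒x∈p-y x∈U x≢u))) ,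
            trans (c≡c' x≢u) (trans (mono x x∈i)
              (trans (sym (mono u u∈i)) (updateAt-updates u c))))
    -- An edge avoiding `u` was already disjoint from `U`, and its colours are unchanged.
    ... | no u∉i = proper i
            (λ (x , x∈) → let (x∈i , x∈U) = x∈p∩q⁻ (edge H i) U x∈ in
              disj (x , x∈p∩q⁺ (x∈i , x∈p∧x≢y⇒x∈p-y x∈U (x≢u x∈i))))
            s' (λ x x∈i → trans (c≡c' (x≢u x∈i)) (mono x x∈i))
      where
      x≢u : ∀ {x} → x ∈ edge H i → x ≢ u
      x≢u x∈i refl = u∉i x∈i

-- Transporting the crown from the Kneser graph to `G`

theorem2 : (t : ℕ) → 1 ≤ t → (G : Graph) → (H : Hypergraph) → G ≅ KG H →
    (d : ℕ) → IsColorabilityDefect H d → t ≤ d → HasMinor G (K t)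
theorem2 t _ G H iso d ((U , refl , c , proper) , minimal) t≤d =
  Crown.crown⇒minor irrefl G-sym (from ∘ edgeAt true) (from ∘ edgeAt false) adj nonadj
  where
  open Inverse (_≅_.bij iso) using (to; from; strictlyInverseˡ)

  adj⇒ : ∀ {x y} → Adj G x y → Adj (KG H) (to x) (to y)
  adj⇒ = Equivalence.to (_≅_.preserve iso _ _)

  adj⇐ : ∀ {i j} → Adj (KG H) i j → Adj G (from i) (from j)
  adj⇐ a = Equivalence.from (_≅_.preserve iso _ _)
    (subst₂ (Adj (KG H)) (sym (strictlyInverseˡ _)) (sym (strictlyInverseˡ _)) a)

  -- Simplicity is not a field of `Graph`; irreflexivity and symmetry are pulled back from `KG H`.
  irrefl : ∀ {x} → ¬ Adj G x x
  irrefl a = proj₁ (adj⇒ a) refl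

  G-sym : Symmetric (Adj G)
  G-sym a with i≢j , empty ← adj⇒ a = Equivalence.from (_≅_.preserve iso _ _)
    (≢-sym i≢j , λ (x , x∈) → let (x∈j , x∈i) = x∈p∩q⁻ _ _ x∈ in empty (x , x∈p∩q⁺ (x∈i , x∈j)))

  -- Of the `d` elements of `U`, the first `t` index the crown.
  ι : Fin t → Fin (m H)
  ι i = proj₁ (elements U) (inject≤ i t≤d)

  ι∈U : ∀ i → ι i ∈ U
  ι∈U i = proj₂ (proj₂ (elements U)) (inject≤ i t≤d)

  ι-injective : Injective _≡_ _≡_ ι
  ι-injective = inject≤-injective t≤d t≤d _ _ ∘ proj₁ (proj₂ (elements U))

  properAt : ∀ i → Empty (edge H i ∩ U) → ∀ s → ¬ (∀ x → x ∈ edge H i → c x ≡ s)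
  properAt i disj true  = proj₁ (proper i disj)
  properAt i disj false = proj₂ (proper i disj)

  criticalAt : ∀ s i → ∃ (Critical H U c s (ι i))
  criticalAt s i = critical-exists H U c properAt minimal s (ι∈U i)

  edgeAt : Bool → Fin t → Fin (k H)
  edgeAt s i = proj₁ (criticalAt s i)

  ι∈edge : ∀ s i → ι i ∈ edge H (edgeAt s i)
  ι∈edge s i = proj₁ (proj₂ (criticalAt s i))

  adj : ∀ {i j} → i ≢ j → Adj G (from (edgeAt true i)) (from (edgeAt false j))
  adj {i} {j} i≢j = adj⇐
    -- If the two edges were equal, `ι i` would lie in their empty intersection.
    ( (λ eq → disj (ι i , x∈p∩q⁺ (ι∈edge true i , subst (λ l → ι i ∈ edge H l) eq (ι∈edge true i))))
    , disj )
    where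
    disj = critical-disjoint H U c (ι∈U i) (ι∈U j) (i≢j ∘ ι-injective)
             (proj₂ (criticalAt true i)) (proj₂ (criticalAt false j))

  nonadj : ∀ i → ¬ Adj G (from (edgeAt true i)) (from (edgeAt false i))
  nonadj i a = proj₂ (subst₂ (Adj (KG H)) (strictlyInverseˡ _) (strictlyInverseˡ _) (adj⇒ a))
    (ι i , x∈p∩q⁺ (ι∈edge true i , ι∈edge false i))
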